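{- Let $\xi_1,\eta_1,\xi_2,\eta_2,\dots$ be independent random variables, each taking the values $1$ and $-1$ with probability $\tfrac12$ each. Put $S_j=\sum_{i=1}^j \xi_i$ and $T_j=\sum_{i=1}^j\eta_i$ for $j\ge 1$, and $S_0=T_0=0$. Then for all integers $m\ge 0$, $n_1\ge 0$, $n_2\ge 0$, $$F(m;n_1,n_2)=4^m\,P\{S_j\ge 0,\ S_j\ge T_j \text{ for } 1\le j\le m,\ S_m=n_1,\ T_m=n_1-2n_2\}.$$ In particular, for all integers $n\ge 0$, $$F(2n;0,0)=4^{2n}\,P\{S_j\ge 0,\ S_j\ge T_j\text{ for }1\le j\le 2n,\ S_{2n}=T_{2n}=0\}.$$
   Context: For integers $m\ge 0$ and $n_1,n_2$, $F(m;n_1,n_2)$ denotes the number of Gessel walks with exactly $m$ steps from $(0,0)$ to $(n_1,n_2)$: lattice walks starting at the origin, each of whose $m$ steps is one of West $(-1,0)$, North-East $(1,1)$, East $(1,0)$, South-West $(-1,-1)$, and which remain in the first quadrant $\{(i,j): i\ge 0, j\ge 0\}$. In particular $F(m;n_1,n_2)=0$ if $n_1<0$ or $n_2<0$, and $F(0;n_1,n_2)=1$ if $n_1=n_2=0$ and $0$ otherwise. -}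

module Defs where

open import Algebra.Bundles using (CommutativeRing)
open import Algebra.Definitions.RawMonoid using () renaming (_×_ to multiple; sum to sumOf)
open import Data.Integer.Base as ℤ using (ℤ; +_; -[1+_])
import Data.Integer.Properties as ℤ
open import Data.Fin.Base using (toℕ)
open import Data.List.Base using (List; []; _∷_; map; foldr; filter; length; cartesianProductWith)
open import Data.List.Relation.Unary.All as All using (All; []; _∷_)
open import Data.List.Relation.Unary.Unique.Propositional using (Unique)
open import Data.Nat.Base as ℕ using (ℕ; zero; suc)
open import Data.Product using (_×_; _,_; ∃; proj₁; proj₂; uncurry)
open import Data.Product.Properties using (≡-dec)
open import Data.Vec.Base using (Vec; []; _∷_)
open import Level using (0ℓ)
open import Relation.Binary.Core using (Rel)
open import Relation.Binary.Definitions using (Cotransitive)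
open import Relation.Binary.PropositionalEquality using (_≡_; _≢_)
open import Relation.Binary.Structures using (IsStrictPartialOrder)
open import Relation.Nullary using (¬_; Dec)
open import Relation.Nullary.Decidable using (_×-dec_)
open import Relation.Unary using (Pred; U; ∁; _∩_; _≐_; _⊥_; ⋃; ⋂)

------------------------------------------------------------------------
-- Gessel walks

Point : Set
Point = ℤ × ℤ

origin : Point
origin = + 0 , + 0

data Step : Set where
  west northEast east southWest : Step

move : Step → Point → Point
move west      (i , j) = i ℤ.- + 1 , j
move northEast (i , j) = i ℤ.+ + 1 , j ℤ.+ + 1
move east      (i , j) = i ℤ.+ + 1 , j
move southWest (i , j) = i ℤ.- + 1 , j ℤ.- + 1

-- All points visited, including the starting point and the endpoint.
visited : ∀ {m} → Point → Vec Step m → List Point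
visited p []      = p ∷ []
visited p (s ∷ w) = p ∷ visited (move s p) w

endpoint : ∀ {m} → Point → Vec Step m → Point
endpoint p []      = p
endpoint p (s ∷ w) = endpoint (move s p) w

InQuadrant : Pred Point 0ℓ
InQuadrant (i , j) = + 0 ℤ.≤ i × + 0 ℤ.≤ j

IsGesselWalkTo : ∀ {m} → Point → Vec Step m → Set
IsGesselWalkTo q w = All InQuadrant (visited origin w) × endpoint origin w ≡ q

isGesselWalkTo? : ∀ {m} (q : Point) (w : Vec Step m) → Dec (IsGesselWalkTo q w)
isGesselWalkTo? q w =
  All.all? (λ (i , j) → (+ 0 ℤ.≤? i) ×-dec (+ 0 ℤ.≤? j)) (visited origin w)
  ×-dec ≡-dec ℤ._≟_ ℤ._≟_ (endpoint origin w) q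

-- Every sequence of m steps, each listed exactly once.
stepSequences : ∀ m → List (Vec Step m)
stepSequences zero    = [] ∷ []
stepSequences (suc m) =
  cartesianProductWith _∷_ (west ∷ northEast ∷ east ∷ southWest ∷ []) (stepSequences m)

F : ℕ → ℤ → ℤ → ℕ
F m n₁ n₂ = length (filter (isGesselWalkTo? (n₁ , n₂)) (stepSequences m))

------------------------------------------------------------------------
-- The real numbers, axiomatised as a complete Archimedean ordered field.
--
-- The axioms are phrased with the strict order so that they hold of
-- constructive reals as well; x ≤ y is ¬ (y < x).

record Reals : Set₁ where
  infix 4 _<_ _≤_
  field
    commutativeRing : CommutativeRing 0ℓ 0ℓ

  open CommutativeRing commutativeRing public

  field
    _<_                  : Rel Carrier 0ℓ
    isStrictPartialOrder : IsStrictPartialOrder _≈_ _<_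
    <-cotransitive       : Cotransitive _<_
    <-tight              : ∀ {x y} → ¬ (x < y) → ¬ (y < x) → x ≈ y
    0<1                  : 0# < 1#
    +-monoʳ-<            : ∀ x {y z} → y < z → x + y < x + z
    *-pos                : ∀ {x y} → 0# < x → 0# < y → 0# < x * y
    inverse              : ∀ {x} → 0# < x → ∃ λ y → x * y ≈ 1#

  open IsStrictPartialOrder isStrictPartialOrder public
    using (<-resp-≈) renaming (trans to <-trans; irrefl to <-irrefl)

  _≤_ : Rel Carrier 0ℓ
  x ≤ y = ¬ (y < x)

  fromℕ : ℕ → Carrier
  fromℕ n = multiple +-rawMonoid n 1#

  Cauchy : (ℕ → Carrier) → Set
  Cauchy a = ∀ ε → 0# < ε →
    ∃ λ N → ∀ k l → N ℕ.≤ k → N ℕ.≤ l → a k - a l < ε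

  _ConvergesTo_ : (ℕ → Carrier) → Carrier → Set
  a ConvergesTo x = ∀ ε → 0# < ε →
    ∃ λ N → ∀ k → N ℕ.≤ k → a k - x < ε × x - a k < ε

  field
    archimedean : ∀ x → ∃ λ n → x < fromℕ n
    complete    : ∀ a → Cauchy a → ∃ λ x → a ConvergesTo x

  partialSums : (ℕ → Carrier) → ℕ → Carrier
  partialSums a n = sumOf +-rawMonoid {n} (λ i → a (toℕ i))

  product : List Carrier → Carrier
  product = foldr _*_ 1#

  0<2 : 0# < 1# + 1#
  0<2 = <-trans 0<1 (proj₂ <-resp-≈ (+-identityʳ 1#) (+-monoʳ-< 1# 0<1))

  ½ : Carrier
  ½ = proj₁ (inverse 0<2)

------------------------------------------------------------------------
-- Probability spaces

-- Closure under countable intersections is classically redundant, but it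
-- does not follow constructively from complements and countable unions.
record ProbabilitySpace (ℝ : Reals) : Set₁ where
  open Reals ℝ
  field
    Ω       : Set
    IsEvent : Pred Ω 0ℓ → Set
    ≐-event : ∀ {A B} → A ≐ B → IsEvent A → IsEvent B
    U-event : IsEvent U
    ∁-event : ∀ {A} → IsEvent A → IsEvent (∁ A)
    ⋃-event : ∀ {A : ℕ → Pred Ω 0ℓ} → (∀ i → IsEvent (A i)) → IsEvent (⋃ ℕ A)
    ⋂-event : ∀ {A : ℕ → Pred Ω 0ℓ} → (∀ i → IsEvent (A i)) → IsEvent (⋂ ℕ A)

    P          : ∀ {A} → IsEvent A → Carrier
    P-cong     : ∀ {A B} → A ≐ B → (a : IsEvent A) (b : IsEvent B) → P a ≈ P b
    P-nonneg   : ∀ {A} (a : IsEvent A) → 0# ≤ P a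
    P-U        : P U-event ≈ 1#
    P-additive : ∀ {A : ℕ → Pred Ω 0ℓ} (a : ∀ i → IsEvent (A i)) →
                 (∀ i j → i ≢ j → A i ⊥ A j) →
                 partialSums (λ i → P (a i)) ConvergesTo P (⋃-event a)

  ∩-event : ∀ {A B} → IsEvent A → IsEvent B → IsEvent (A ∩ B)
  ∩-event {A} {B} a b = ≐-event
    ((λ h → h 0 , h 1) , λ { (x , y) zero → x ; (x , y) (suc _) → y })
    (⋂-event {C} c)
    where
    C : ℕ → Pred Ω 0ℓ
    C zero    = A
    C (suc _) = B
    c : ∀ i → IsEvent (C i)
    c zero    = a
    c (suc _) = b

  All-event : ∀ {I : Set} {A : I → Pred Ω 0ℓ} → (∀ i → IsEvent (A i)) →
              ∀ is → IsEvent (λ ω → All (λ i → A i ω) is)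
  All-event a []       = ≐-event ((λ _ → []) , _) U-event
  All-event a (i ∷ is) = ≐-event (uncurry _∷_ , All.uncons)
                                 (∩-event (a i) (All-event a is))

  -- An integer-valued random variable; since ℤ is countable, measurability
  -- may be tested on points.
  record RandomVariable : Set where
    field
      value      : Ω → ℤ
      measurable : ∀ k → IsEvent (λ ω → value ω ≡ k)

  open RandomVariable public

  FairSign : RandomVariable → Set
  FairSign X = P (measurable X (+ 1)) ≈ ½ × P (measurable X -[1+ 0 ]) ≈ ½

  -- Mutual independence of a family of discrete random variables:
  -- P {X i = x i for all i in J} = ∏_{i ∈ J} P {X i = x i}, J finite.
  Independent : {I : Set} → (I → RandomVariable) → Set
  Independent {I} X = ∀ (J : List I) → Unique J → (x : I → ℤ) →
    P (All-event (λ i → measurable (X i) (x i)) J)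
      ≈ product (map (λ i → P (measurable (X i) (x i))) J)

  -- partialSum X j = X₁ + … + X_j, where the j-th variable X_j of a sequence
  -- numbered from 1 is X (j - 1).
  partialSum : (ℕ → RandomVariable) → ℕ → Ω → ℤ
  partialSum X zero    ω = + 0
  partialSum X (suc j) ω = partialSum X j ω ℤ.+ value (X j) ω

  StaysInWedge : (S T : ℕ → Ω → ℤ) → ℕ → Pred Ω 0ℓ
  StaysInWedge S T m ω =
    ∀ j → 1 ℕ.≤ j → j ℕ.≤ m → + 0 ℤ.≤ S j ω × T j ω ℤ.≤ S j ω

{-# OPTIONS --safe #-}

-- A Gessel step (di , dj) is encoded by the pair of signs (di , di - 2dj). This is a
-- bijection between the four steps and the four sign pairs, under which the walk is
-- at (i , j) at time k exactly when S k = i and T k = i - 2j; hence the quadrant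
-- becomes the wedge S ≥ 0, S ≥ T. By independence each of the 4^m step sequences is
-- followed with probability 4^-m, and these events exhaust the space up to a null set
-- (on which the random variables may take values other than ±1).
module Submission where

open import Defs
open import Algebra.Bundles using (CommutativeRing)
open import Algebra.Definitions.RawMonoid using () renaming (_×_ to multiple)
import Algebra.Properties.CommutativeSemigroup as CommutativeSemigroupProperties
import Algebra.Properties.Group as GroupProperties
import Algebra.Properties.Monoid.Sum as SumProperties
import Algebra.Properties.Semiring.Mult as MultProperties
open import Data.Integer.Base as ℤ using (ℤ; +_; -[1+_])
import Data.Integer.Properties as ℤ
open import Data.Integer.Tactic.RingSolver using (solve-∀)
open import Data.List.Base using (List; []; _∷_; _++_; map; filter; length; cartesianProductWith)
open import Data.List.Relation.Unary.All as All using (All; []; _∷_)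
open import Data.List.Relation.Unary.AllPairs using ([]; _∷_)
open import Data.List.Relation.Unary.Unique.Propositional using (Unique)
open import Data.Nat.Base as ℕ using (ℕ; zero; suc; z≤n; s≤s)
import Data.Nat.Properties as ℕ
open import Data.Product using (_×_; _,_; ∃; proj₁; proj₂)
open import Data.Sum.Base using (_⊎_; inj₁; inj₂; [_,_]′)
open import Data.Vec.Base using (Vec; []; _∷_)
open import Function.Base using (_∘_; id)
open import Level using (0ℓ)
open import Relation.Binary.PropositionalEquality as ≡ using (_≡_; _≢_; refl; cong; subst)
import Relation.Binary.Reasoning.Setoid as SetoidReasoning
open import Relation.Nullary using (¬_; Dec; yes; no)
open import Relation.Nullary.Decidable using (_×-dec_; map′)
open import Relation.Unary using (Pred; Decidable; U; ∅; ∁; _∩_; _∪_; _≐_; _⊆_; _⊥_; ⋃)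

-- Order, limits, powers of one quarter and finite sums in the reals.

module RealProperties (ℝ : Reals) where
  open Reals ℝ hiding (zero) renaming (refl to ≈-refl; sym to ≈-sym; trans to ≈-trans)
  open GroupProperties +-group public using () renaming (∙-cancelˡ to +-cancelˡ)
  open SumProperties +-monoid public using (sum-replicate)
  open MultProperties semiring public using (×1-homo-*)
  open SetoidReasoning setoid

  <-respʳ : ∀ {x y z} → y ≈ z → x < y → x < z
  <-respʳ = proj₁ <-resp-≈

  <-respˡ : ∀ {x y z} → y ≈ z → y < x → z < x
  <-respˡ = proj₂ <-resp-≈

  x<y⇒0<y-x : ∀ {x y} → x < y → 0# < y - x
  x<y⇒0<y-x {x} x<y =
    <-respˡ (-‿inverseˡ x) (<-respʳ (+-comm _ _) (+-monoʳ-< (- x) x<y))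

  x+y-x≈y : ∀ x y → (x + y) - x ≈ y
  x+y-x≈y x y = begin
    (x + y) - x    ≈⟨ +-congʳ (+-comm x y) ⟩
    (y + x) - x    ≈⟨ +-assoc y x (- x) ⟩
    y + (x - x)    ≈⟨ +-congˡ (-‿inverseʳ x) ⟩
    y + 0#         ≈⟨ +-identityʳ y ⟩
    y              ∎

  -- By `<-tight` it is enough to refute both strict inequalities. If one held, the gap between `c`
  -- and `x` could serve as the tolerance, and at an index beyond both thresholds the gap would be
  -- smaller than itself.
  eventually-constant-limit : ∀ {a x c} N → (∀ k → N ℕ.≤ k → a k ≈ c) → a ConvergesTo x → c ≈ x
  eventually-constant-limit {a} {x} {c} N const lim = <-tight c≮x x≮c
    where
    c≮x : ¬ (c < x)
    c≮x c<x with lim (x - c) (x<y⇒0<y-x c<x)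
    ... | M , close = <-irrefl (+-congˡ (-‿cong (const _ (ℕ.m≤m⊔n N M))))
                               (proj₂ (close _ (ℕ.m≤n⊔m N M)))
    x≮c : ¬ (x < c)
    x≮c x<c with lim (c - x) (x<y⇒0<y-x x<c)
    ... | M , close = <-irrefl (+-congʳ (const _ (ℕ.m≤m⊔n N M)))
                               (proj₁ (close _ (ℕ.m≤n⊔m N M)))

  convergesTo-cong : ∀ {a b x y} → (∀ k → a k ≈ b k) → x ≈ y → a ConvergesTo x → b ConvergesTo y
  convergesTo-cong a≈b x≈y lim ε 0<ε with lim ε 0<ε
  ... | N , close = N , λ k N≤k →
    <-respˡ (+-cong (a≈b k) (-‿cong x≈y)) (proj₁ (close k N≤k)) ,
    <-respˡ (+-cong x≈y (-‿cong (a≈b k))) (proj₂ (close k N≤k))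

  infixr 8 _⋆_
  _⋆_ : ℕ → Carrier → Carrier
  _⋆_ = multiple +-rawMonoid

  x<x+y : ∀ x {y} → 0# < y → x < x + y
  x<x+y x 0<y = <-respˡ (+-identityʳ x) (+-monoʳ-< x 0<y)

  0<suc⋆ : ∀ n {x} → 0# < x → 0# < suc n ⋆ x
  0<suc⋆ zero    {x} 0<x = <-respʳ (≈-sym (+-identityʳ x)) 0<x
  0<suc⋆ (suc n) {x} 0<x = <-trans 0<x (x<x+y x (0<suc⋆ n 0<x))

  multiples-limit-zero : ∀ {x} → 0# ≤ x → (λ n → n ⋆ x) ConvergesTo x → x ≈ 0#
  multiples-limit-zero {x} 0≤x lim = <-tight 0≤x 0≮x
    where
    0≮x : ¬ (0# < x)
    0≮x 0<x with lim x 0<x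
    ... | N , close =
      <-irrefl ≈-refl (<-trans (x<x+y x (0<suc⋆ N 0<x))
        (<-respˡ (x+y-x≈y x _)
          -- With tolerance `x`, convergence gives `(2 + N) ⋆ x < x`, one copy of `x` having been
          -- subtracted. Of the remaining copies one is matched against the right side, and
          -- `suc N ⋆ x` is still positive.
          (proj₁ (close (3 ℕ.+ N) (ℕ.m≤n+m N 3)))))

  x+y≈0⇒x≈0 : ∀ {x y} → 0# ≤ x → 0# ≤ y → x + y ≈ 0# → x ≈ 0#
  x+y≈0⇒x≈0 {x} {y} 0≤x 0≤y x+y≈0 = <-tight 0≤x λ 0<x →
    0≤y (<-respʳ (≈-trans (+-comm y x) x+y≈0) (x<x+y y 0<x))

  2*½≈1 : (1# + 1#) * ½ ≈ 1#
  2*½≈1 = proj₂ (inverse 0<2)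

  ½+½≈1 : ½ + ½ ≈ 1#
  ½+½≈1 = begin
    ½ + ½              ≈⟨ +-cong (*-identityˡ ½) (*-identityˡ ½) ⟨
    1# * ½ + 1# * ½    ≈⟨ distribʳ ½ 1# 1# ⟨
    (1# + 1#) * ½      ≈⟨ 2*½≈1 ⟩
    1#                 ∎

  -- Two factors `½` per step, one for each sign, so that the power unfolds in the same shape as the
  -- product over `indices`.
  ¼^_ : ℕ → Carrier
  ¼^ zero    = 1#
  ¼^ (suc m) = ½ * (½ * ¼^ m)

  4½½≈1 : ∀ x → fromℕ 4 * (½ * (½ * x)) ≈ x
  4½½≈1 x = begin
    fromℕ 4 * (½ * (½ * x))               ≈⟨ *-congʳ (×1-homo-* 2 2) ⟩
    (fromℕ 2 * fromℕ 2) * (½ * (½ * x))   ≈⟨ *-assoc _ _ _ ⟩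
    fromℕ 2 * (fromℕ 2 * (½ * (½ * x)))   ≈⟨ *-congˡ (cancel (½ * x)) ⟩
    fromℕ 2 * (½ * x)                     ≈⟨ cancel x ⟩
    x                                     ∎
    where
    cancel : ∀ y → fromℕ 2 * (½ * y) ≈ y
    cancel y = begin
      fromℕ 2 * (½ * y)      ≈⟨ *-assoc _ _ _ ⟨
      (fromℕ 2 * ½) * y      ≈⟨ *-congʳ (*-congʳ (+-congˡ (+-identityʳ 1#))) ⟩
      ((1# + 1#) * ½) * y    ≈⟨ *-congʳ 2*½≈1 ⟩
      1# * y                 ≈⟨ *-identityˡ y ⟩
      y                      ∎

  4^m*¼^m≈1 : ∀ m → fromℕ (4 ℕ.^ m) * ¼^ m ≈ 1#
  4^m*¼^m≈1 zero    = ≈-trans (*-identityʳ _) (+-identityʳ 1#)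
  4^m*¼^m≈1 (suc m) = begin
    fromℕ (4 ℕ.* 4 ℕ.^ m) * ¼^ (suc m)           ≈⟨ *-congʳ (×1-homo-* 4 (4 ℕ.^ m)) ⟩
    (fromℕ 4 * fromℕ (4 ℕ.^ m)) * ¼^ (suc m)     ≈⟨ *-congʳ (*-comm _ _) ⟩
    (fromℕ (4 ℕ.^ m) * fromℕ 4) * ¼^ (suc m)     ≈⟨ *-assoc _ _ _ ⟩
    fromℕ (4 ℕ.^ m) * (fromℕ 4 * ¼^ (suc m))     ≈⟨ *-congˡ (4½½≈1 (¼^ m)) ⟩
    fromℕ (4 ℕ.^ m) * ¼^ m                       ≈⟨ 4^m*¼^m≈1 m ⟩
    1#                                           ∎

  ∑ : {A : Set} → List A → (A → Carrier) → Carrier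
  ∑ []       f = 0#
  ∑ (x ∷ xs) f = f x + ∑ xs f

  ∑-cong : ∀ {A : Set} {f g : A → Carrier} xs → (∀ x → f x ≈ g x) → ∑ xs f ≈ ∑ xs g
  ∑-cong []       f≈g = ≈-refl
  ∑-cong (x ∷ xs) f≈g = +-cong (f≈g x) (∑-cong xs f≈g)

  ∑-map++ : ∀ {A B : Set} (h : A → B) (f : B → Carrier) xs ys →
            ∑ (map h xs ++ ys) f ≈ ∑ xs (f ∘ h) + ∑ ys f
  ∑-map++ h f []       ys = ≈-sym (+-identityˡ _)
  ∑-map++ h f (x ∷ xs) ys = ≈-trans (+-congˡ (∑-map++ h f xs ys)) (≈-sym (+-assoc _ _ _))

  ∑-cartesianProductWith : ∀ {A B C : Set} (h : A → B → C) (f : C → Carrier) xs ys →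
    ∑ (cartesianProductWith h xs ys) f ≈ ∑ xs (λ x → ∑ ys (f ∘ h x))
  ∑-cartesianProductWith h f []       ys = ≈-refl
  ∑-cartesianProductWith h f (x ∷ xs) ys =
    ≈-trans (∑-map++ (h x) f ys _) (+-congˡ (∑-cartesianProductWith h f xs ys))

  -- Turns a total probability into a count: `Q` will be the property of being a Gessel walk to a
  -- given point, and `c` the common probability of a single step sequence.
  ∑-filter : ∀ {A : Set} {Q : Pred A 0ℓ} (Q? : Decidable Q) {f : A → Carrier} {c} →
             (∀ x → Q x → f x ≈ c) → (∀ x → ¬ Q x → f x ≈ 0#) →
             ∀ xs → ∑ xs f ≈ fromℕ (length (filter Q? xs)) * c
  ∑-filter Q? {f} {c} on off []       = ≈-sym (zeroˡ c)
  ∑-filter Q? {f} {c} on off (x ∷ xs) with Q? x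
  ... | yes q = begin
    f x + ∑ xs f                                     ≈⟨ +-cong (on x q) (∑-filter Q? on off xs) ⟩
    c + fromℕ (length (filter Q? xs)) * c            ≈⟨ +-congʳ (*-identityˡ c) ⟨
    1# * c + fromℕ (length (filter Q? xs)) * c       ≈⟨ distribʳ c _ _ ⟨
    fromℕ (suc (length (filter Q? xs))) * c          ∎
  ... | no ¬q = begin
    f x + ∑ xs f                                     ≈⟨ +-cong (off x ¬q) (∑-filter Q? on off xs) ⟩
    0# + fromℕ (length (filter Q? xs)) * c           ≈⟨ +-identityˡ _ ⟩
    fromℕ (length (filter Q? xs)) * c                ∎

-- Finite additivity, measurability and splitting along a fair sign.

module Probability {ℝ : Reals} (𝒫 : ProbabilitySpace ℝ) where
  open Reals ℝ hiding (zero) renaming (refl to ≈-refl; sym to ≈-sym; trans to ≈-trans)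
  open ProbabilitySpace 𝒫
  open RealProperties ℝ
  open SetoidReasoning setoid

  ∅-event : IsEvent ∅
  ∅-event = ≐-event ((λ ¬u → ¬u _) , λ ()) (∁-event U-event)

  -- The empty event is the disjoint union of countably many copies of itself, so the multiples of
  -- its probability converge to that probability.
  P-∅ : P ∅-event ≈ 0#
  P-∅ = multiples-limit-zero (P-nonneg ∅-event)
    (convergesTo-cong (λ k → sum-replicate k) (P-cong (proj₂ , λ ()) _ _)
      (P-additive (λ _ → ∅-event) (λ _ _ _ → proj₁)))

  infix 4 _then_
  -- Pads two events with empty ones, so that the countable axioms yield binary unions and binary
  -- additivity.
  _then_ : Pred Ω 0ℓ → Pred Ω 0ℓ → ℕ → Pred Ω 0ℓ
  (A then B) 0             = A
  (A then B) 1             = B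
  (A then B) (suc (suc _)) = ∅

  then-event : ∀ {A B} → IsEvent A → IsEvent B → ∀ i → IsEvent ((A then B) i)
  then-event a b 0             = a
  then-event a b 1             = b
  then-event a b (suc (suc _)) = ∅-event

  ⋃-then : ∀ {A B} → ⋃ ℕ (A then B) ≐ A ∪ B
  ⋃-then = (λ { (0 , x) → inj₁ x ; (1 , x) → inj₂ x }) ,
           (λ { (inj₁ x) → 0 , x ; (inj₂ x) → 1 , x })

  ∪-event : ∀ {A B} → IsEvent A → IsEvent B → IsEvent (A ∪ B)
  ∪-event a b = ≐-event ⋃-then (⋃-event (then-event a b))

  -- In the padded sequence the partial sums are constant from index 2 on, because the tail consists
  -- of empty events. An arbitrary `C` equivalent to the union is allowed so that no particular
  -- proof of measurability is imposed.
  P-∪ : ∀ {A B C} (c : IsEvent C) (a : IsEvent A) (b : IsEvent B) →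
        C ≐ A ∪ B → A ⊥ B → P c ≈ P a + P b
  P-∪ {A} {B} c a b (C⊆ , ⊆C) A⊥B = begin
    P c                              ≈⟨ P-cong (proj₂ ⋃-then ∘ C⊆ , ⊆C ∘ proj₁ ⋃-then) c _ ⟩
    P (⋃-event (then-event a b))     ≈⟨ eventually-constant-limit 2 constant (P-additive _ disjoint) ⟨
    P a + P b                        ∎
    where
    disjoint : ∀ i j → i ≢ j → (A then B) i ⊥ (A then B) j
    disjoint 0             0             i≢j _       = i≢j refl
    disjoint 0             1             _   x       = A⊥B x
    disjoint 1             0             _   (x , y) = A⊥B (y , x)
    disjoint 1             1             i≢j _       = i≢j refl
    disjoint 0             (suc (suc _)) _   (_ , ())
    disjoint 1             (suc (suc _)) _   (_ , ())
    disjoint (suc (suc _)) _             _   (() , _)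
    constant : ∀ k → 2 ℕ.≤ k → partialSums (λ i → P (then-event a b i)) k ≈ P a + P b
    constant (suc zero) (s≤s ())
    constant (suc (suc k)) _ = begin
      P a + (P b + partialSums (λ _ → P ∅-event) k)  ≈⟨ +-congˡ (+-congˡ (sum-replicate k)) ⟩
      P a + (P b + k ⋆ P ∅-event)                    ≈⟨ +-congˡ (+-congˡ (⋆-zero k)) ⟩
      P a + (P b + 0#)                               ≈⟨ +-congˡ (+-identityʳ (P b)) ⟩
      P a + P b                                      ∎
      where
      ⋆-zero : ∀ k → k ⋆ P ∅-event ≈ 0#
      ⋆-zero zero    = ≈-refl
      ⋆-zero (suc k) = ≈-trans (+-cong P-∅ (⋆-zero k)) (+-identityˡ 0#)

  -- Decidability of `A` supplies the case distinction that constructive logic does not give for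
  -- free.
  P-split : ∀ {A B} (b : IsEvent B) (a : IsEvent A) → Decidable A →
            P b ≈ P (∩-event b a) + P (∩-event b (∁-event a))
  P-split {A} {B} b a A? =
    P-∪ b (∩-event b a) (∩-event b (∁-event a)) (split , merge) (λ ((_ , x) , (_ , ¬x)) → ¬x x)
    where
    split : B ⊆ (B ∩ A) ∪ (B ∩ ∁ A)
    split {ω} y with A? ω
    ... | yes x = inj₁ (y , x)
    ... | no ¬x = inj₂ (y , ¬x)
    merge : (B ∩ A) ∪ (B ∩ ∁ A) ⊆ B
    merge (inj₁ (y , _)) = y
    merge (inj₂ (y , _)) = y

  P-null-∩ : ∀ {A N} (n : IsEvent N) (a : IsEvent A) → Decidable A →
             P n ≈ 0# → P (∩-event n a) ≈ 0#
  P-null-∩ n a A? Pn≈0 =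
    x+y≈0⇒x≈0 (P-nonneg _) (P-nonneg _) (≈-trans (≈-sym (P-split n a A?)) Pn≈0)

  const-event : ∀ {Q : Set} → Dec Q → IsEvent (λ _ → Q)
  const-event (yes q) = ≐-event ((λ _ → q) , _) U-event
  const-event (no ¬q) = ≐-event ((λ ()) , ¬q) ∅-event

  -- The integers are enumerated in pairs `+ n`, `-[1+ n]`, which reduces the union to one over the
  -- naturals.
  ⋃ℤ-event : ∀ {A : ℤ → Pred Ω 0ℓ} → (∀ k → IsEvent (A k)) → IsEvent (⋃ ℤ A)
  ⋃ℤ-event a = ≐-event
    ((λ { (n , inj₁ x) → + n , x ; (n , inj₂ x) → -[1+ n ] , x }) ,
     (λ { (+ n , x) → n , inj₁ x ; (-[1+ n ] , x) → n , inj₂ x }))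
    (⋃-event (λ n → ∪-event (a (+ n)) (a -[1+ n ])))

  -- Splits along the countably many values of `X`. Nested uses fix several variables in turn, until
  -- a predicate on plain integers remains.
  value-event : (X : RandomVariable) {A : ℤ → Pred Ω 0ℓ} → (∀ k → IsEvent (A k)) →
                IsEvent (λ ω → A (value X ω) ω)
  value-event X {A} a = ≐-event
    ((λ { (_ , refl , x) → x }) , (λ x → _ , refl , x))
    (⋃ℤ-event (λ k → ∩-event (measurable X k) (a k)))

  partialSumᴿ : (ℕ → RandomVariable) → ℕ → RandomVariable
  partialSumᴿ X j .value = partialSum X j
  partialSumᴿ X zero    .measurable k = const-event (+ 0 ℤ.≟ k)
  partialSumᴿ X (suc j) .measurable k =
    value-event (partialSumᴿ X j) λ i → value-event (X j) λ l → const-event (i ℤ.+ l ℤ.≟ k)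

  -- The values 1 and -1 already carry total probability 1, so the event of taking neither is null,
  -- and so is its intersection with the given event.
  P-fair : (X : RandomVariable) → FairSign X → ∀ {A} (a : IsEvent A) → Decidable A →
           P a ≈ P (∩-event a (measurable X (+ 1))) + P (∩-event a (measurable X -[1+ 0 ]))
  P-fair X (P+ , P-) a A? = begin
    P a
      ≈⟨ P-split a e₊ E₊? ⟩
    P (∩-event a e₊) + P (∩-event a (∁-event e₊))
      ≈⟨ +-congˡ (P-split _ e₋ E₋?) ⟩
    P (∩-event a e₊) + (P (∩-event (∩-event a (∁-event e₊)) e₋) + P (∩-event (∩-event a (∁-event e₊)) (∁-event e₋)))
      ≈⟨ +-congˡ (+-cong
           (P-cong ((λ ((x , _) , y) → x , y) , λ (x , y) → (x , λ z → 1≢-1 (≡.trans (≡.sym z) y)) , y) _ _)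
           (≈-trans (P-cong ((λ ((x , y) , z) → (y , z) , x) , λ ((y , z) , x) → (x , y) , z) _ _)
                    (P-null-∩ null a A? P-null≈0))) ⟩
    P (∩-event a e₊) + (P (∩-event a e₋) + 0#)
      ≈⟨ +-congˡ (+-identityʳ _) ⟩
    P (∩-event a e₊) + P (∩-event a e₋) ∎
    where
    e₊ = measurable X (+ 1)
    e₋ = measurable X -[1+ 0 ]
    E₊? : Decidable (λ ω → value X ω ≡ + 1)
    E₊? ω = value X ω ℤ.≟ + 1
    E₋? : Decidable (λ ω → value X ω ≡ -[1+ 0 ])
    E₋? ω = value X ω ℤ.≟ -[1+ 0 ]
    1≢-1 : + 1 ≢ -[1+ 0 ]
    1≢-1 ()
    null : IsEvent (∁ (λ ω → value X ω ≡ + 1) ∩ ∁ (λ ω → value X ω ≡ -[1+ 0 ]))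
    null = ∩-event (∁-event e₊) (∁-event e₋)
    P-null≈0 : P null ≈ 0#
    -- Read from the bottom up, the chain splits the whole space by the value 1 and then the
    -- complement by the value -1. The pieces are `½`, `½` and `P null`, with sum 1.
    P-null≈0 = +-cancelˡ 1# (P null) 0# (begin
      1# + P null
        ≈⟨ +-congʳ ½+½≈1 ⟨
      (½ + ½) + P null
        ≈⟨ +-assoc ½ ½ (P null) ⟩
      ½ + (½ + P null)
        ≈⟨ +-cong P+ (+-congʳ P-) ⟨
      P e₊ + (P e₋ + P null)
        ≈⟨ +-cong (P-cong ((λ x → _ , x) , proj₂) _ _)
             (+-congʳ (P-cong ((λ y → (λ z → 1≢-1 (≡.trans (≡.sym z) y)) , y) , proj₂) _ _)) ⟩
      P (∩-event U-event e₊) + (P (∩-event (∁-event e₊) e₋) + P null)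
        ≈⟨ +-congˡ (P-split (∁-event e₊) e₋ E₋?) ⟨
      P (∩-event U-event e₊) + P (∁-event e₊)
        ≈⟨ +-congˡ (P-cong ((λ x → _ , x) , proj₂) _ _) ⟩
      P (∩-event U-event e₊) + P (∩-event U-event (∁-event e₊))
        ≈⟨ P-split U-event e₊ E₊? ⟨
      P U-event
        ≈⟨ P-U ⟩
      1#
        ≈⟨ +-identityʳ 1# ⟨
      1# + 0# ∎)

-- Steps as sign pairs, the quadrant as a wedge, and the indices of the signs.

ξ-sign : Step → ℤ
ξ-sign west      = -[1+ 0 ]
ξ-sign northEast = + 1
ξ-sign east      = + 1
ξ-sign southWest = -[1+ 0 ]

η-sign : Step → ℤ
η-sign west      = -[1+ 0 ]
η-sign northEast = -[1+ 0 ]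
η-sign east      = + 1
η-sign southWest = + 1

At : Point → Pred (ℤ × ℤ) 0ℓ
At (i , j) (s , t) = s ≡ i × t ≡ i ℤ.- + 2 ℤ.* j

InWedge : Pred (ℤ × ℤ) 0ℓ
InWedge (s , t) = + 0 ℤ.≤ s × t ℤ.≤ s

At-move : ∀ a p {s t} → At p (s , t) → At (move a p) (s ℤ.+ ξ-sign a , t ℤ.+ η-sign a)
At-move a (i , j) (refl , refl) = first a , second a
  where
  first : ∀ a → i ℤ.+ ξ-sign a ≡ proj₁ (move a (i , j))
  first west      = refl
  first northEast = refl
  first east      = refl
  first southWest = refl
  at-west : ∀ i j → i ℤ.- + 2 ℤ.* j ℤ.+ -[1+ 0 ] ≡ i ℤ.- + 1 ℤ.- + 2 ℤ.* j
  at-west = solve-∀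
  at-northEast : ∀ i j → i ℤ.- + 2 ℤ.* j ℤ.+ -[1+ 0 ] ≡ i ℤ.+ + 1 ℤ.- + 2 ℤ.* (j ℤ.+ + 1)
  at-northEast = solve-∀
  at-east : ∀ i j → i ℤ.- + 2 ℤ.* j ℤ.+ + 1 ≡ i ℤ.+ + 1 ℤ.- + 2 ℤ.* j
  at-east = solve-∀
  at-southWest : ∀ i j → i ℤ.- + 2 ℤ.* j ℤ.+ + 1 ≡ i ℤ.- + 1 ℤ.- + 2 ℤ.* (j ℤ.- + 1)
  at-southWest = solve-∀
  second : ∀ a → i ℤ.- + 2 ℤ.* j ℤ.+ η-sign a ≡
                 proj₁ (move a (i , j)) ℤ.- + 2 ℤ.* proj₂ (move a (i , j))
  second west      = at-west i j
  second northEast = at-northEast i j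
  second east      = at-east i j
  second southWest = at-southWest i j

-- The difference `s - t` is twice the second coordinate. Hence `t ≤ s` amounts to `0 ≤ j`, and
-- cancelling the 2 recovers `j` from the two sums.
i-[i-2j]≡2j : ∀ i j → i ℤ.- (i ℤ.- + 2 ℤ.* j) ≡ + 2 ℤ.* j
i-[i-2j]≡2j = solve-∀

inQuadrant⇒inWedge : ∀ {p x} → At p x → InQuadrant p → InWedge x
inQuadrant⇒inWedge {i , j} (refl , refl) (0≤i , 0≤j) =
  0≤i , ℤ.0≤i-j⇒j≤i (subst (+ 0 ℤ.≤_) (≡.sym (i-[i-2j]≡2j i j)) (ℤ.*-monoˡ-≤-nonNeg (+ 2) 0≤j))

inWedge⇒inQuadrant : ∀ {p x} → At p x → InWedge x → InQuadrant p
inWedge⇒inQuadrant {i , j} (refl , refl) (0≤s , t≤s) =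
  0≤s , ℤ.*-cancelˡ-≤-pos (+ 0) j (+ 2) (subst (+ 0 ℤ.≤_) (i-[i-2j]≡2j i j) (ℤ.i≤j⇒0≤j-i t≤s))

At-injective : ∀ {p q x} → At p x → At q x → p ≡ q
At-injective {i , j} {_ , l} (refl , refl) (refl , eq) = cong (i ,_)
  (ℤ.*-cancelˡ-≡ (+ 2) j l (≡.trans (≡.sym (i-[i-2j]≡2j i j))
    (≡.trans (cong (ℤ._-_ i) eq) (i-[i-2j]≡2j i l))))

-- The tags `inj₁` and `inj₂` select from `ξ` and `η` in the joint family `[ ξ , η ]′`. The two
-- signs of a step stand next to each other, as in `Follows`.
indices : ℕ → ℕ → List (ℕ ⊎ ℕ)
indices k zero    = []
indices k (suc m) = inj₁ k ∷ inj₂ k ∷ indices (suc k) m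

-- Independence is formulated for lists without repetition. The two heads differ in their tags, and
-- all later numbers exceed `k`.
indices-unique : ∀ k m → Unique (indices k m)
indices-unique k zero    = []
indices-unique k (suc m) =
  ((λ ()) ∷ All.map (λ { {inj₁ _} lt refl → ℕ.<-irrefl refl lt ; {inj₂ _} _ () }) (indices-≥ (suc k) m)) ∷
  All.map (λ { {inj₁ _} _ () ; {inj₂ _} lt refl → ℕ.<-irrefl refl lt }) (indices-≥ (suc k) m) ∷
  indices-unique (suc k) m
  where
  indices-≥ : ∀ k m → All (λ i → k ℕ.≤ [ id , id ]′ i) (indices k m)
  indices-≥ k zero    = []
  indices-≥ k (suc m) = ℕ.≤-refl ∷ ℕ.≤-refl ∷ All.map ℕ.<⇒≤ (indices-≥ (suc k) m)

-- Past its end a step sequence is continued by an arbitrary step.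
stepAt : ∀ {m} → Vec Step m → ℕ → Step
stepAt []      _       = west
stepAt (a ∷ w) zero    = a
stepAt (a ∷ w) (suc i) = stepAt w i

-- Sample paths that follow a given step sequence.

module SimpleWalks {ℝ : Reals} (𝒫 : ProbabilitySpace ℝ) (ξ η : ℕ → ProbabilitySpace.RandomVariable 𝒫) where
  open Reals ℝ hiding (zero) renaming (refl to ≈-refl; sym to ≈-sym; trans to ≈-trans)
  open ProbabilitySpace 𝒫
  open RealProperties ℝ
  open Probability 𝒫
  open SetoidReasoning setoid

  S T : ℕ → Ω → ℤ
  S = partialSum ξ
  T = partialSum η

  Wedge : ℕ → Pred Ω 0ℓ
  Wedge k ω = InWedge (S k ω , T k ω)

  -- Replaces the bounded quantifier by a recursion on `m`, from which both decidability and
  -- measurability follow.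
  StaysInWedge-suc : ∀ m → StaysInWedge S T m ∩ Wedge (suc m) ≐ StaysInWedge S T (suc m)
  StaysInWedge-suc m = extend , λ h →
    (λ j 1≤j j≤m → h j 1≤j (ℕ.m≤n⇒m≤1+n j≤m)) , h (suc m) (s≤s z≤n) ℕ.≤-refl
    where
    extend : StaysInWedge S T m ∩ Wedge (suc m) ⊆ StaysInWedge S T (suc m)
    extend (h , x) j 1≤j j≤1+m with ℕ.m≤n⇒m<n∨m≡n j≤1+m
    ... | inj₁ (s≤s j≤m) = h j 1≤j j≤m
    ... | inj₂ refl      = x

  StaysInWedge-zero : U ⊆ StaysInWedge S T 0
  StaysInWedge-zero _ _ (s≤s _) ()

  staysInWedge? : ∀ m → Decidable (StaysInWedge S T m)
  staysInWedge? zero    ω = yes (StaysInWedge-zero _)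
  staysInWedge? (suc m) ω = map′ (proj₁ (StaysInWedge-suc m)) (proj₂ (StaysInWedge-suc m))
    (staysInWedge? m ω ×-dec (+ 0 ℤ.≤? S (suc m) ω) ×-dec (T (suc m) ω ℤ.≤? S (suc m) ω))

  staysInWedge-event : ∀ m → IsEvent (StaysInWedge S T m)
  staysInWedge-event zero    = ≐-event (StaysInWedge-zero , _) U-event
  staysInWedge-event (suc m) = ≐-event (StaysInWedge-suc m) (∩-event (staysInWedge-event m) (∩-event
    (value-event (partialSumᴿ ξ (suc m)) λ s → const-event (+ 0 ℤ.≤? s))
    -- The comparison involves two variables: first the value `t` of the second sum is fixed, then
    -- the value `s` of the first.
    (value-event (partialSumᴿ η (suc m)) λ t →
     value-event (partialSumᴿ ξ (suc m)) λ s → const-event (t ℤ.≤? s))))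

  -- Numbering from 0 makes `ξ k` and `η k` the increments from time `k` to time `suc k`.
  Takes : ℕ → Step → Pred Ω 0ℓ
  Takes k a ω = value (ξ k) ω ≡ ξ-sign a × value (η k) ω ≡ η-sign a

  takes-event : ∀ k a → IsEvent (Takes k a)
  takes-event k a = ∩-event (measurable (ξ k) (ξ-sign a)) (measurable (η k) (η-sign a))

  takes? : ∀ k a → Decidable (Takes k a)
  takes? k a ω = (value (ξ k) ω ℤ.≟ ξ-sign a) ×-dec (value (η k) ω ℤ.≟ η-sign a)

  Follows : ∀ {m} → ℕ → Vec Step m → Pred Ω 0ℓ
  Follows k []      = U
  Follows k (a ∷ w) = Takes k a ∩ Follows (suc k) w

  follows-event : ∀ {m} k (w : Vec Step m) → IsEvent (Follows k w)
  follows-event k []      = U-event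
  follows-event k (a ∷ w) = ∩-event (takes-event k a) (follows-event (suc k) w)

  takes⇒At : ∀ {k p ω} a → Takes k a ω → At p (S k ω , T k ω) → At (move a p) (S (suc k) ω , T (suc k) ω)
  takes⇒At {k} {p} {ω} a (x , y) at
    rewrite x | y = At-move a p at

  follows⇒At-endpoint : ∀ {m k p ω} (w : Vec Step m) → Follows k w ω → At p (S k ω , T k ω) →
                        At (endpoint p w) (S (k ℕ.+ m) ω , T (k ℕ.+ m) ω)
  follows⇒At-endpoint {k = k} [] _ at rewrite ℕ.+-identityʳ k = at
  follows⇒At-endpoint {suc m} {k} (a ∷ w) (x , y) at rewrite ℕ.+-suc k m =
    follows⇒At-endpoint w y (takes⇒At a x at)

  -- The start time and start point are arbitrary so that the induction can pass to the tail. A time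
  -- `l` is either the current one, settled by the head of the visited list, or belongs to the tail.
  visited⇒wedge : ∀ {m k p ω} (w : Vec Step m) → Follows k w ω → At p (S k ω , T k ω) →
                  All InQuadrant (visited p w) → ∀ l → k ℕ.≤ l → l ℕ.≤ k ℕ.+ m → Wedge l ω
  visited⇒wedge {k = k} [] _ at (q ∷ []) l k≤l l≤k+0
    with refl ← ℕ.≤-antisym k≤l (subst (l ℕ.≤_) (ℕ.+-identityʳ k) l≤k+0) = inQuadrant⇒inWedge at q
  visited⇒wedge {suc m} {k} (a ∷ w) (x , y) at (q ∷ qs) l k≤l l≤k+m with ℕ.m≤n⇒m<n∨m≡n k≤l
  ... | inj₁ k<l  = visited⇒wedge w y (takes⇒At a x at) qs l k<l (subst (l ℕ.≤_) (ℕ.+-suc k m) l≤k+m)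
  ... | inj₂ refl = inQuadrant⇒inWedge at q

  wedge⇒visited : ∀ {m k p ω} (w : Vec Step m) → Follows k w ω → At p (S k ω , T k ω) →
                  (∀ l → k ℕ.≤ l → l ℕ.≤ k ℕ.+ m → Wedge l ω) → All InQuadrant (visited p w)
  wedge⇒visited {k = k} [] _ at h = inWedge⇒inQuadrant at (h k ℕ.≤-refl (ℕ.m≤m+n k 0)) ∷ []
  wedge⇒visited {suc m} {k} (a ∷ w) (x , y) at h =
    inWedge⇒inQuadrant at (h k ℕ.≤-refl (ℕ.m≤m+n k (suc m))) ∷
    wedge⇒visited w y (takes⇒At a x at)
      (λ l k<l l≤ → h l (ℕ.<⇒≤ k<l) (subst (l ℕ.≤_) (≡.sym (ℕ.+-suc k m)) l≤))

  Reaches : ℕ → Point → Pred Ω 0ℓ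
  Reaches m (i , j) ω = StaysInWedge S T m ω × S m ω ≡ i × T m ω ≡ i ℤ.- + 2 ℤ.* j

  reaches-event : ∀ m q → IsEvent (Reaches m q)
  reaches-event m (i , j) = ∩-event (staysInWedge-event m) (∩-event
    (measurable (partialSumᴿ ξ m) i) (measurable (partialSumᴿ η m) (i ℤ.- + 2 ℤ.* j)))

  reaches? : ∀ m q → Decidable (Reaches m q)
  reaches? m (i , j) ω =
    staysInWedge? m ω ×-dec (S m ω ℤ.≟ i) ×-dec (T m ω ℤ.≟ i ℤ.- + 2 ℤ.* j)

  gesselWalk⇒reaches : ∀ {m q ω} (w : Vec Step m) → Follows 0 w ω → IsGesselWalkTo q w → Reaches m q ω
  gesselWalk⇒reaches w f (qs , refl) =
    (λ l _ l≤m → visited⇒wedge w f (refl , refl) qs l z≤n l≤m) , follows⇒At-endpoint w f (refl , refl)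

  reaches⇒gesselWalk : ∀ {m q ω} (w : Vec Step m) → Follows 0 w ω → Reaches m q ω → IsGesselWalkTo q w
  reaches⇒gesselWalk {m} {ω = ω} w f (h , at) =
    wedge⇒visited w f (refl , refl) wedge , At-injective (follows⇒At-endpoint w f (refl , refl)) at
    where
    wedge : ∀ l → 0 ℕ.≤ l → l ℕ.≤ m → Wedge l ω
    -- `StaysInWedge` begins at time 1, whereas the visited points include the origin. At time 0
    -- both sums vanish.
    wedge zero    _ _   = ℤ.≤-refl , ℤ.≤-refl
    wedge (suc l) _ l≤m = h (suc l) (s≤s z≤n) l≤m

  -- Independence takes one assignment of values to all indices, so the steps come from a function
  -- `σ` on all times, of which `w` is the stretch starting at `k`.
  follows≐All : ∀ {m k} (w : Vec Step m) (σ : ℕ → Step) → (∀ i → σ (k ℕ.+ i) ≡ stepAt w i) →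
    Follows k w ≐ (λ ω → All (λ i → value ([ ξ , η ]′ i) ω ≡ [ ξ-sign ∘ σ , η-sign ∘ σ ]′ i) (indices k m))
  follows≐All []      σ _    = (λ _ → []) , _
  follows≐All {k = k} (a ∷ w) σ σ≡
    -- Agreement at offset 0 identifies the head `a` with `σ k`.
    with refl ← ≡.trans (cong σ (≡.sym (ℕ.+-identityʳ k))) (σ≡ 0)
    with to , from ← follows≐All {k = suc k} w σ (λ i → ≡.trans (cong σ (≡.sym (ℕ.+-suc k i))) (σ≡ (suc i))) =
    (λ ((x , y) , z) → x ∷ y ∷ to z) , (λ { (x ∷ y ∷ z) → (x , y) , from z })

  -- Total probability over step sequences, and the count.

  module _ (ξ-fair : ∀ i → FairSign (ξ i)) (η-fair : ∀ i → FairSign (η i)) where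

    P-total-step : ∀ k {A} (a : IsEvent A) → Decidable A →
      P a ≈ ∑ (west ∷ northEast ∷ east ∷ southWest ∷ []) (λ s → P (∩-event a (takes-event k s)))
    P-total-step k {A} a A? = begin
      P a
        ≈⟨ P-fair (ξ k) (ξ-fair k) a A? ⟩
      P ξ₊ + P ξ₋
        ≈⟨ +-cong (P-fair (η k) (η-fair k) ξ₊ (λ ω → A? ω ×-dec (value (ξ k) ω ℤ.≟ + 1)))
                  (P-fair (η k) (η-fair k) ξ₋ (λ ω → A? ω ×-dec (value (ξ k) ω ℤ.≟ -[1+ 0 ]))) ⟩
      (P (∩-event ξ₊ η₊) + P (∩-event ξ₊ η₋)) + (P (∩-event ξ₋ η₊) + P (∩-event ξ₋ η₋))
        ≈⟨ +-cong (+-cong (P-cong assoc _ _) (P-cong assoc _ _)) (+-cong (P-cong assoc _ _) (P-cong assoc _ _)) ⟩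
      -- The sign pairs (1,1), (1,-1), (-1,1), (-1,-1) encode these four steps in this order. What
      -- follows rearranges them into the order used by `stepSequences`.
      (p east + p northEast) + (p southWest + p west)
        ≈⟨ +-cong (+-comm _ _) (+-comm _ _) ⟩
      (p northEast + p east) + (p west + p southWest)
        ≈⟨ x∙yz≈y∙xz _ _ _ ⟩
      p west + ((p northEast + p east) + p southWest)
        ≈⟨ +-congˡ (+-assoc _ _ _) ⟩
      p west + (p northEast + (p east + p southWest))
        ≈⟨ +-congˡ (+-congˡ (+-congˡ (+-identityʳ _))) ⟨
      p west + (p northEast + (p east + (p southWest + 0#))) ∎
      where
      open CommutativeSemigroupProperties (CommutativeRing.+-commutativeSemigroup commutativeRing)
      ξ₊ = ∩-event a (measurable (ξ k) (+ 1))
      ξ₋ = ∩-event a (measurable (ξ k) -[1+ 0 ])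
      η₊ = measurable (η k) (+ 1)
      η₋ = measurable (η k) -[1+ 0 ]
      p : Step → Carrier
      p s = P (∩-event a (takes-event k s))
      assoc : ∀ {B C : Pred Ω 0ℓ} → (A ∩ B) ∩ C ≐ A ∩ (B ∩ C)
      assoc = (λ ((x , y) , z) → x , y , z) , (λ (x , y , z) → (x , y) , z)

    -- Splits by the first step and recurses on the event intersected with it, one time unit later.
    -- For this reason the event and the start time are arbitrary.
    P-total : ∀ m k {A} (a : IsEvent A) → Decidable A →
      P a ≈ ∑ (stepSequences m) (λ w → P (∩-event a (follows-event k w)))
    P-total zero    k a A? = ≈-trans (P-cong ((λ x → x , _) , proj₁) _ _) (≈-sym (+-identityʳ _))
    P-total (suc m) k a A? = begin
      P a
        ≈⟨ P-total-step k a A? ⟩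
      ∑ steps (λ s → P (∩-event a (takes-event k s)))
        ≈⟨ ∑-cong steps P-total-tail ⟩
      ∑ steps (λ s → ∑ (stepSequences m) λ w → P (∩-event a (follows-event k (s ∷ w))))
        ≈⟨ ∑-cartesianProductWith _∷_ _ steps (stepSequences m) ⟨
      ∑ (stepSequences (suc m)) (λ w → P (∩-event a (follows-event k w))) ∎
      where
      steps = west ∷ northEast ∷ east ∷ southWest ∷ []
      P-total-tail : ∀ s → P (∩-event a (takes-event k s)) ≈
                           ∑ (stepSequences m) (λ w → P (∩-event a (follows-event k (s ∷ w))))
      P-total-tail s = ≈-trans
        (P-total m (suc k) (∩-event a (takes-event k s)) (λ ω → A? ω ×-dec takes? k s ω))
        (∑-cong (stepSequences m) λ w → P-cong
          ((λ ((x , y) , z) → x , y , z) , (λ (x , y , z) → (x , y) , z))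
          (∩-event (∩-event a (takes-event k s)) (follows-event (suc k) w))
          (∩-event a (follows-event k (s ∷ w))))

    module _ (independent : Independent [ ξ , η ]′) where

      -- Following `w` prescribes the values of `2m` distinct members of the joint family, each
      -- prescribed value having probability `½`.
      P-follows : ∀ {m} (w : Vec Step m) → P (follows-event 0 w) ≈ ¼^ m
      P-follows {m} w = begin
        P (follows-event 0 w)
          ≈⟨ P-cong (follows≐All w σ (λ _ → refl)) _ _ ⟩
        P (All-event (λ i → measurable ([ ξ , η ]′ i) (sign i)) (indices 0 m))
          ≈⟨ independent (indices 0 m) (indices-unique 0 m) sign ⟩
        product (map (λ i → P (measurable ([ ξ , η ]′ i) (sign i))) (indices 0 m))
          ≈⟨ product-signs 0 m ⟩
        ¼^ m ∎
        where
        σ : ℕ → Step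
        σ = stepAt w
        sign : ℕ ⊎ ℕ → ℤ
        sign = [ ξ-sign ∘ σ , η-sign ∘ σ ]′
        P-ξ-sign : ∀ k a → P (measurable (ξ k) (ξ-sign a)) ≈ ½
        P-ξ-sign k west      = proj₂ (ξ-fair k)
        P-ξ-sign k northEast = proj₁ (ξ-fair k)
        P-ξ-sign k east      = proj₁ (ξ-fair k)
        P-ξ-sign k southWest = proj₂ (ξ-fair k)
        P-η-sign : ∀ k a → P (measurable (η k) (η-sign a)) ≈ ½
        P-η-sign k west      = proj₂ (η-fair k)
        P-η-sign k northEast = proj₂ (η-fair k)
        P-η-sign k east      = proj₁ (η-fair k)
        P-η-sign k southWest = proj₁ (η-fair k)
        product-signs : ∀ k m →
          product (map (λ i → P (measurable ([ ξ , η ]′ i) (sign i))) (indices k m)) ≈ ¼^ m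
        product-signs k zero    = ≈-refl
        product-signs k (suc m) =
          *-cong (P-ξ-sign k (σ k)) (*-cong (P-η-sign k (σ k)) (product-signs (suc k) m))

      -- On the event that `w` is followed, reaching the point means exactly that `w` is a Gessel
      -- walk to it. Each summand is therefore the full probability `¼^ m` of following `w`, or that
      -- of the empty event.
      P-reaches : ∀ m i j → P (reaches-event m (i , j)) ≈ fromℕ (F m i j) * ¼^ m
      P-reaches m i j = ≈-trans
        (P-total m 0 (reaches-event m (i , j)) (reaches? m (i , j)))
        (∑-filter (isGesselWalkTo? (i , j))
          (λ w walk → ≈-trans
            (P-cong (proj₂ , λ f → gesselWalk⇒reaches w f walk , f) _ _) (P-follows w))
          (λ w ¬walk → ≈-trans
            (P-cong ((λ (r , f) → ¬walk (reaches⇒gesselWalk w f r)) , λ ()) _ _) P-∅)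
          (stepSequences m))

      F≈4^m*P : ∀ m i j → fromℕ (F m i j) ≈ fromℕ (4 ℕ.^ m) * P (reaches-event m (i , j))
      F≈4^m*P m i j = begin
        fromℕ (F m i j)                                     ≈⟨ *-identityʳ _ ⟨
        fromℕ (F m i j) * 1#                                ≈⟨ *-congˡ (4^m*¼^m≈1 m) ⟨
        fromℕ (F m i j) * (fromℕ (4 ℕ.^ m) * ¼^ m)          ≈⟨ *-assoc _ _ _ ⟨
        (fromℕ (F m i j) * fromℕ (4 ℕ.^ m)) * ¼^ m          ≈⟨ *-congʳ (*-comm _ _) ⟩
        (fromℕ (4 ℕ.^ m) * fromℕ (F m i j)) * ¼^ m          ≈⟨ *-assoc _ _ _ ⟩
        fromℕ (4 ℕ.^ m) * (fromℕ (F m i j) * ¼^ m)          ≈⟨ *-congˡ (P-reaches m i j) ⟨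
        fromℕ (4 ℕ.^ m) * P (reaches-event m (i , j))       ∎

lemma1 :
    (ℝ : Reals) (𝒫 : ProbabilitySpace ℝ) →
    let open Reals ℝ
        open ProbabilitySpace 𝒫
    in
    (ξ η : ℕ → RandomVariable) →
    (∀ i → FairSign (ξ i)) →
    (∀ i → FairSign (η i)) →
    Independent [ ξ , η ]′ →
    let S = partialSum ξ
        T = partialSum η
    in
    (∀ (m n₁ n₂ : ℕ) →
      ∃ λ (e : IsEvent (λ ω → StaysInWedge S T m ω ×
                              S m ω ≡ + n₁ ×
                              T m ω ≡ + n₁ ℤ.- + 2 ℤ.* + n₂)) →
        fromℕ (F m (+ n₁) (+ n₂)) ≈ fromℕ (4 ℕ.^ m) * P e)
    ×
    (∀ (n : ℕ) →
      ∃ λ (e : IsEvent (λ ω → StaysInWedge S T (2 ℕ.* n) ω ×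
                              S (2 ℕ.* n) ω ≡ + 0 ×
                              T (2 ℕ.* n) ω ≡ + 0)) →
        fromℕ (F (2 ℕ.* n) (+ 0) (+ 0)) ≈ fromℕ (4 ℕ.^ (2 ℕ.* n)) * P e)
lemma1 ℝ 𝒫 ξ η ξ-fair η-fair independent =
  (λ m n₁ n₂ → reaches-event m (+ n₁ , + n₂) , F≈4^m*P ξ-fair η-fair independent m (+ n₁) (+ n₂)) ,
  -- At the origin the target `+ 0 ℤ.- + 2 ℤ.* + 0` of the second sum computes to `+ 0`, so the
  -- event has the required form by definition.
  (λ n → reaches-event (2 ℕ.* n) origin , F≈4^m*P ξ-fair η-fair independent (2 ℕ.* n) (+ 0) (+ 0))
  where
  open SimpleWalks 𝒫 ξ η
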